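{- $w^\ast(2,3)=17$. That is, every 2-coloring of $\{1,\dots,17\}$ contains a monochromatic double 3-term arithmetic progression, while the 2-coloring of $\{1,\dots,16\}$ given by the word $0010110100101101$ (the $n$-th letter being the color of $n$) contains no monochromatic double 3-term arithmetic progression.
   Context: An increasing sequence of positive integers $a_1<a_2<\cdots$ (finite or infinite) contains a double 3-term arithmetic progression if there are indices $i<j<k$ with $i+k=2j$ and $a_i+a_k=2a_j$. For a coloring of an interval, each color class is regarded as an increasing sequence by listing its elements in increasing order; a monochromatic double 3-term arithmetic progression is a double 3-term arithmetic progression in some color class. For integers $r,k$, $w^\ast(r,k)$ denotes the least integer $N$, if it exists, such that every $r$-coloring of $\{1,\dots,N\}$ has a monochromatic double $k$-term arithmetic progression (defined analogously with $k$ indices in arithmetic progression whose values are also in arithmetic progression). -}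

module Defs where

open import Data.Fin using (Fin; toℕ; _≟_) renaming (_<_ to _<ᶠ_)
open import Data.Fin.Patterns using (0F; 1F)
open import Data.List using (List; length; map; filter; allFin; lookup)
open import Data.Nat using (ℕ; suc; _+_; _*_; _<_; _≤_)
open import Data.Product using (∃₂; Σ-syntax; ∃-syntax; _×_)
import Data.Vec as Vec
open Vec using (Vec; []; _∷_)
open import Function using (_∘_)
open import Relation.Binary.PropositionalEquality using (_≡_)

-- A finite sequence a₁ < a₂ < ⋯ is the list of its terms.  List positions
-- start at 0 rather than 1; both conditions on indices below (being in
-- arithmetic progression, i + k = 2j) are invariant under this shift.

-- The common difference is required to be positive: for indices this says
-- that they are distinct and listed in increasing order, and for values of an
-- increasing sequence at increasing indices it is automatic (if k ≥ 2).
IsAP : ∀ {k} → (Fin k → ℕ) → Set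
IsAP f = ∃₂ λ a d → 0 < d × (∀ j → f j ≡ a + toℕ j * d)

HasDoubleAP : ℕ → List ℕ → Set
HasDoubleAP k as =
  Σ[ ι ∈ (Fin k → Fin (length as)) ]
    IsAP (toℕ ∘ ι) × IsAP (lookup as ∘ ι)

HasDouble3AP : List ℕ → Set
HasDouble3AP as =
  ∃[ i ] ∃[ j ] ∃[ k ]
    i <ᶠ j × j <ᶠ k ×
    toℕ i + toℕ k ≡ 2 * toℕ j ×
    lookup as i + lookup as k ≡ 2 * lookup as j

-- An r-coloring of {1, …, N}; x : Fin N stands for the integer suc (toℕ x).
Coloring : ℕ → ℕ → Set
Coloring r N = Fin N → Fin r

-- In increasing order, since allFin is.
colorClass : ∀ {r N} → Coloring r N → Fin r → List ℕ
colorClass {N = N} χ c = map (suc ∘ toℕ) (filter (λ x → χ x ≟ c) (allFin N))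

HasMonoDoubleAP : ∀ {r N} → ℕ → Coloring r N → Set
HasMonoDoubleAP k χ = ∃[ c ] HasDoubleAP k (colorClass χ c)

HasMonoDouble3AP : ∀ {r N} → Coloring r N → Set
HasMonoDouble3AP χ = ∃[ c ] HasDouble3AP (colorClass χ c)

-- w*(r,k) need not exist a priori, so "w*(r,k) = N" is a relation.
IsW* : (r k N : ℕ) → Set
IsW* r k N =
  (∀ (χ : Coloring r N) → HasMonoDoubleAP k χ) ×
  (∀ M → (∀ (χ : Coloring r M) → HasMonoDoubleAP k χ) → N ≤ M)

word : Vec (Fin 2) 16
word = 0F ∷ 0F ∷ 1F ∷ 0F ∷ 1F ∷ 1F ∷ 0F ∷ 1F ∷
       0F ∷ 0F ∷ 1F ∷ 0F ∷ 1F ∷ 1F ∷ 0F ∷ 1F ∷ []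

wordColoring : Coloring 2 16
wordColoring = Vec.lookup word

{-# OPTIONS --safe #-}
-- Restricting a coloring of {1, …, N + 1} to {2, …, N + 1} and shifting it down
-- creates no new double progression: indices and values of each class move by
-- constants.  So the words without a monochromatic double 3-term progression
-- are closed under taking tails, and they can be listed by length, extending
-- the words of length N by one letter in front.  There are at most 60 of each
-- length, and none of length 17.
module Submission where

open import Defs
open import Data.Fin as Fin using (Fin; toℕ; cast; _≟_; _<?_) renaming (_<_ to _<ᶠ_)
open import Data.Fin.Patterns using (0F; 1F; 2F)
open import Data.Fin.Properties using (any?; toℕ-cast)
open import Data.List using (List; []; _∷_; length; map; filter; allFin; lookup; cartesianProductWith; tabulate)
open import Data.List.Membership.Propositional using (_∈_)
open import Data.List.Membership.Propositional.Properties
  using (∈-filter⁺; ∈-cartesianProductWith⁺; ∈-allFin; ∈-lookup)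
open import Data.List.Properties using (length-map; map-tabulate; map-∘; filter-≐)
import Data.List.Relation.Unary.All as All
open import Data.List.Relation.Unary.AllPairs using (AllPairs; _∷_)
import Data.List.Relation.Unary.AllPairs.Properties as AllPairs
open import Data.List.Relation.Unary.Any using (here)
import Data.List.Relation.Unary.Any.Properties as Any
import Data.Nat as ℕ
open ℕ using (ℕ; zero; suc; _+_; _*_; _∸_; _<_; _≤_; z<s; s<s; s≤s⁻¹; s<s⁻¹)
open import Data.Nat.Properties
  using (*-distribˡ-+; *-monoˡ-<; +-monoʳ-<; m<n⇒0<n∸m; m+[n∸m]≡n; <⇒≤; +-cancelˡ-≡; +-identityʳ; *-identityˡ; ≮⇒≥; ≤⇒≤′)
open import Data.Nat.Tactic.RingSolver using (solve-∀)
open import Data.Product using (_×_; _,_)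
open import Data.Vec as Vec using (Vec; []; _∷_)
open import Data.Vec.Properties using (lookup∘tabulate)
open import Function using (_∘_; id)
open import Relation.Binary.PropositionalEquality
open import Relation.Nullary using (¬_; Dec; yes; no)
open import Relation.Nullary.Decidable using (decidable-stable; from-no; ¬?; _×-dec_)
open import Relation.Unary using (Pred; Decidable)

private
  variable
    k r M N : ℕ
    as : List ℕ

midpoint-shift : ∀ s {x y z} → x + z ≡ 2 * y → (s + x) + (s + z) ≡ 2 * (s + y)
midpoint-shift s {x} {y} {z} eq = begin
  (s + x) + (s + z)  ≡⟨ regroup s x z ⟩
  2 * s + (x + z)    ≡⟨ cong (2 * s +_) eq ⟩
  2 * s + 2 * y      ≡⟨ *-distribˡ-+ 2 s y ⟨
  2 * (s + y)        ∎
  where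
  open ≡-Reasoning
  regroup : ∀ s x z → (s + x) + (s + z) ≡ 2 * s + (x + z)
  regroup = solve-∀

-- Order and both midpoint equations survive translation, and indices and values may be translated
-- by different amounts. Passing from a tail to the whole coloring uses `0 , 1` for renumbering and
-- `1 , 0` for a new first term.
HasDouble3AP-shift : ∀ as bs s t (ι : Fin (length as) → Fin (length bs)) →
  (∀ i → toℕ (ι i) ≡ s + toℕ i) → (∀ i → lookup bs (ι i) ≡ t + lookup as i) →
  HasDouble3AP as → HasDouble3AP bs
HasDouble3AP-shift as bs s t ι toℕ-ι lookup-ι (i , j , k , i<j , j<k , idx , val) =
  ι i , ι j , ι k , ι-mono i<j , ι-mono j<k , idx′ , val′
  where
  ι-mono : ∀ {x y} → x <ᶠ y → ι x <ᶠ ι y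
  ι-mono {x} {y} x<y = subst₂ _<_ (sym (toℕ-ι x)) (sym (toℕ-ι y)) (+-monoʳ-< s x<y)

  idx′ : toℕ (ι i) + toℕ (ι k) ≡ 2 * toℕ (ι j)
  idx′ rewrite toℕ-ι i | toℕ-ι j | toℕ-ι k = midpoint-shift s idx

  val′ : lookup bs (ι i) + lookup bs (ι k) ≡ 2 * lookup bs (ι j)
  val′ rewrite lookup-ι i | lookup-ι j | lookup-ι k = midpoint-shift t val

lookup-map-cast : ∀ {a b} {A : Set a} {B : Set b} (f : A → B) xs i →
  lookup (map f xs) (cast (sym (length-map f xs)) i) ≡ f (lookup xs i)
lookup-map-cast f (x ∷ xs) Fin.zero    = refl
lookup-map-cast f (x ∷ xs) (Fin.suc i) = lookup-map-cast f xs i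

HasDouble3AP-map-suc : ∀ as → HasDouble3AP as → HasDouble3AP (map suc as)
HasDouble3AP-map-suc as =
  -- The two lengths agree only propositionally, so positions are carried over by `cast`.
  HasDouble3AP-shift as (map suc as) 0 1 (cast (sym (length-map suc as)))
    (toℕ-cast _) (lookup-map-cast suc as)

HasDouble3AP-∷ : ∀ a as → HasDouble3AP as → HasDouble3AP (a ∷ as)
HasDouble3AP-∷ a as = HasDouble3AP-shift as (a ∷ as) 1 0 Fin.suc (λ _ → refl) (λ _ → refl)

filter-map : ∀ {a b p} {A : Set a} {B : Set b} {P : Pred B p} (P? : Decidable P)
  (f : A → B) xs → filter P? (map f xs) ≡ map f (filter (P? ∘ f) xs)
filter-map P? f []       = refl
filter-map P? f (x ∷ xs) with P? (f x)
... | yes _ = cong (f x ∷_) (filter-map P? f xs)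
... | no  _ = filter-map P? f xs

-- The left side is what remains of `colorClass χ c` once `filter` has decided on the integer 1.
colorClass-tail : (χ : Coloring r (suc N)) (c : Fin r) →
  map (suc ∘ toℕ) (filter (λ x → χ x ≟ c) (tabulate Fin.suc)) ≡
  map suc (colorClass (χ ∘ Fin.suc) c)
colorClass-tail {N = N} χ c = begin
  map (suc ∘ toℕ) (filter (λ x → χ x ≟ c) (tabulate Fin.suc))
    ≡⟨ cong (map (suc ∘ toℕ) ∘ filter (λ x → χ x ≟ c)) (map-tabulate id Fin.suc) ⟨
  map (suc ∘ toℕ) (filter (λ x → χ x ≟ c) (map Fin.suc (allFin N)))
    ≡⟨ cong (map (suc ∘ toℕ)) (filter-map (λ x → χ x ≟ c) Fin.suc (allFin N)) ⟩
  map (suc ∘ toℕ) (map Fin.suc (filter (λ x → χ (Fin.suc x) ≟ c) (allFin N)))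
    ≡⟨ map-∘ _ ⟨
  map (suc ∘ suc ∘ toℕ) (filter (λ x → χ (Fin.suc x) ≟ c) (allFin N))
    ≡⟨ map-∘ _ ⟩
  map suc (colorClass (χ ∘ Fin.suc) c) ∎
  where open ≡-Reasoning

HasMonoDouble3AP-tail : (χ : Coloring r (suc N)) →
  HasMonoDouble3AP (χ ∘ Fin.suc) → HasMonoDouble3AP χ
HasMonoDouble3AP-tail χ (c , h) = c , inClass
  where
  inTail : HasDouble3AP (map (suc ∘ toℕ) (filter (λ x → χ x ≟ c) (tabulate Fin.suc)))
  inTail = subst HasDouble3AP (sym (colorClass-tail χ c)) (HasDouble3AP-map-suc (colorClass (χ ∘ Fin.suc) c) h)

  inClass : HasDouble3AP (colorClass χ c)
  -- If 1 has color `c`, it heads the class and every index moves up by one; otherwise the indices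
  -- stay.
  inClass with χ Fin.zero ≟ c
  ... | yes _ = HasDouble3AP-∷ 1 _ inTail
  ... | no  _ = inTail

-- This stands in for function extensionality when passing between colorings and vectors.
HasMonoDouble3AP-≗ : {χ ψ : Coloring r N} → χ ≗ ψ → HasMonoDouble3AP χ → HasMonoDouble3AP ψ
HasMonoDouble3AP-≗ {N = N} {χ} {ψ} χ≗ψ (c , h) = c ,
  subst HasDouble3AP
    (cong (map (suc ∘ toℕ))
      (filter-≐ (λ x → χ x ≟ c) (λ x → ψ x ≟ c)
        ((λ {x} → trans (sym (χ≗ψ x))) , (λ {x} → trans (χ≗ψ x))) (allFin N)))
    h

hasDouble3AP? : ∀ as → Dec (HasDouble3AP as)
hasDouble3AP? as =
  any? λ i → any? λ j → any? λ k →
    i <? j ×-dec j <? k ×-dec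
    toℕ i + toℕ k ℕ.≟ 2 * toℕ j ×-dec
    lookup as i + lookup as k ℕ.≟ 2 * lookup as j

hasMonoDouble3AP? : (χ : Coloring r N) → Dec (HasMonoDouble3AP χ)
hasMonoDouble3AP? χ = any? λ c → hasDouble3AP? (colorClass χ c)

avoiders : ∀ r N → List (Vec (Fin r) N)
avoiders r zero    = [] ∷ []
avoiders r (suc N) = filter (λ w → ¬? (hasMonoDouble3AP? (Vec.lookup w)))
  (cartesianProductWith _∷_ (allFin r) (avoiders r N))

∈-avoiders : (χ : Coloring r N) → ¬ HasMonoDouble3AP χ → Vec.tabulate χ ∈ avoiders r N
∈-avoiders {N = zero}  χ ¬h = here refl
∈-avoiders {N = suc N} χ ¬h =
  ∈-filter⁺ (λ w → ¬? (hasMonoDouble3AP? (Vec.lookup w)))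
    (∈-cartesianProductWith⁺ _∷_ (∈-allFin (χ Fin.zero))
      (∈-avoiders (χ ∘ Fin.suc) (¬h ∘ HasMonoDouble3AP-tail χ)))
    -- The filter tests `Vec.lookup (Vec.tabulate χ)`, which agrees with `χ` only pointwise.
    (¬h ∘ HasMonoDouble3AP-≗ (lookup∘tabulate χ))

unavoidable : avoiders r N ≡ [] → (χ : Coloring r N) → HasMonoDouble3AP χ
unavoidable none χ = decidable-stable (hasMonoDouble3AP? χ) λ ¬h →
  Any.¬Any[] (subst (Vec.tabulate χ ∈_) none (∈-avoiders χ ¬h))

-- A longer coloring contains a coloring of length `M` as an iterated tail.
unavoidable-mono : M ≤ N → (∀ (χ : Coloring r M) → HasMonoDouble3AP χ) →
  ∀ (χ : Coloring r N) → HasMonoDouble3AP χ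
unavoidable-mono M≤N all = go (≤⇒≤′ M≤N)
  where
  go : ∀ {N} → _ ℕ.≤′ N → ∀ (χ : Coloring _ N) → HasMonoDouble3AP χ
  go (ℕ.≤′-reflexive refl) χ = all χ
  go (ℕ.≤′-step M≤′N)      χ = HasMonoDouble3AP-tail χ (go M≤′N (χ ∘ Fin.suc))

midpoint⇒IsAP : (f : Fin 3 → ℕ) → f 0F < f 1F → f 0F + f 2F ≡ 2 * f 1F → IsAP f
midpoint⇒IsAP f x<y mid = f 0F , d , m<n⇒0<n∸m x<y , terms
  where
  -- The truncated subtraction is exact because `f 0F < f 1F`.
  d = f 1F ∸ f 0F

  y≡x+d : f 1F ≡ f 0F + d
  y≡x+d = sym (m+[n∸m]≡n (<⇒≤ x<y))

  terms : ∀ j → f j ≡ f 0F + toℕ j * d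
  terms 0F = sym (+-identityʳ _)
  terms 1F = trans y≡x+d (cong (f 0F +_) (sym (*-identityˡ d)))
  terms 2F = +-cancelˡ-≡ (f 0F) _ _ (begin
    f 0F + f 2F            ≡⟨ mid ⟩
    2 * f 1F               ≡⟨ cong (2 *_) y≡x+d ⟩
    2 * (f 0F + d)         ≡⟨ double (f 0F) d ⟩
    f 0F + (f 0F + 2 * d)  ∎)
    where
    open ≡-Reasoning
    double : ∀ x e → 2 * (x + e) ≡ x + (x + 2 * e)
    double = solve-∀

IsAP⇒midpoint : (f : Fin 3 → ℕ) → IsAP f → f 0F + f 2F ≡ 2 * f 1F
IsAP⇒midpoint f (a , d , _ , terms) rewrite terms 0F | terms 1F | terms 2F = double a d
  where
  double : ∀ a d → (a + 0 * d) + (a + 2 * d) ≡ 2 * (a + 1 * d)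
  double = solve-∀

-- The positive common difference of the indices is what yields `i < j < k` in `HasDouble3AP`.
IsAP⇒increasing : (f : Fin k → ℕ) → IsAP f → ∀ {i j} → i <ᶠ j → f i < f j
IsAP⇒increasing f (a , d , 0<d , terms) {i} {j} i<j =
  subst₂ _<_ (sym (terms i)) (sym (terms j))
    (+-monoʳ-< a (*-monoˡ-< d ⦃ ℕ.>-nonZero 0<d ⦄ i<j))

lookup-increasing : AllPairs _<_ as → ∀ {i j} → i <ᶠ j → lookup as i < lookup as j
lookup-increasing {a ∷ as} (a< ∷ _)  {Fin.zero}  {Fin.suc j} _   = All.lookup a< (∈-lookup j)
lookup-increasing {a ∷ as} (_ ∷ as<) {Fin.suc i} {Fin.suc j} i<j = lookup-increasing as< (s<s⁻¹ i<j)

-- Makes the common difference of the values positive, as `IsAP` demands.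
colorClass-increasing : (χ : Coloring r N) (c : Fin r) → AllPairs _<_ (colorClass χ c)
colorClass-increasing χ c =
  AllPairs.map⁺ (AllPairs.filter⁺ (λ x → χ x ≟ c) (AllPairs.tabulate⁺-< s<s))

HasMonoDouble3AP⇒HasMonoDoubleAP : (χ : Coloring r N) → HasMonoDouble3AP χ → HasMonoDoubleAP 3 χ
HasMonoDouble3AP⇒HasMonoDoubleAP χ (c , i , j , k , i<j , _ , idx , val) =
  c , ι , midpoint⇒IsAP (toℕ ∘ ι) i<j idx ,
  midpoint⇒IsAP (lookup (colorClass χ c) ∘ ι)
    (lookup-increasing (colorClass-increasing χ c) i<j) val
  where
  ι = Vec.lookup (i ∷ j ∷ k ∷ [])

HasDoubleAP⇒HasDouble3AP : ∀ as → HasDoubleAP 3 as → HasDouble3AP as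
HasDoubleAP⇒HasDouble3AP as (ι , idx , val) =
  ι 0F , ι 1F , ι 2F ,
  IsAP⇒increasing (toℕ ∘ ι) idx {0F} {1F} z<s ,
  IsAP⇒increasing (toℕ ∘ ι) idx {1F} {2F} (s<s z<s) ,
  IsAP⇒midpoint (toℕ ∘ ι) idx ,
  IsAP⇒midpoint (lookup as ∘ ι) val

HasMonoDoubleAP⇒HasMonoDouble3AP : (χ : Coloring r N) → HasMonoDoubleAP 3 χ → HasMonoDouble3AP χ
HasMonoDoubleAP⇒HasMonoDouble3AP χ (c , h) = c , HasDoubleAP⇒HasDouble3AP (colorClass χ c) h

theorem1 : IsW* 2 3 17
    × (∀ (χ : Coloring 2 17) → HasMonoDouble3AP χ)
    × ¬ HasMonoDouble3AP wordColoring
theorem1 =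
  ((λ χ → HasMonoDouble3AP⇒HasMonoDoubleAP χ (upper χ)) , least) , upper , lower
  where
  upper : ∀ (χ : Coloring 2 17) → HasMonoDouble3AP χ
  -- Here `refl` makes the type checker evaluate `avoiders 2 17` to the empty list.
  upper = unavoidable refl

  lower : ¬ HasMonoDouble3AP wordColoring
  lower = from-no (hasMonoDouble3AP? wordColoring)

  least : ∀ M → (∀ (χ : Coloring 2 M) → HasMonoDoubleAP 3 χ) → 17 ≤ M
  -- If `M` were at most 16, unavoidability would pass from `M` up to 16, where `wordColoring`
  -- refutes it.
  least M all = ≮⇒≥ λ M<17 → lower
    (unavoidable-mono (s≤s⁻¹ M<17) (λ χ → HasMonoDoubleAP⇒HasMonoDouble3AP χ (all χ)) wordColoring)
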